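{- Let $x=(x_1,x_2,\dots,x_n)$ be a binary sequence of length $n>53$ with $x_1=1$ whose first $53$ elements have run length encoding $(5,5,5,5,10,10,9,4)$ or $(5,5,10,5,15,5,4,1,3)$. Put $p=5$, $t=26$, and $z_j=x_{p(j-1)+1}$. Then $x_i=1$ for $1\le i\le p$, $x_{p+1}=-1$, and $x$ satisfies equation $(k)$ for all $1\le k\le t=26$, but $z$ does not satisfy equation $(k)$ for $k=5$, although $5\le\frac{t}{p}$.
   Context: A binary sequence of length $n$ is $x=(x_1,\dots,x_n)$ with each $x_i\in\{ -1,1\}$. For $1\le k<\frac{n-1}{2}$, the sequence $x$ is said to satisfy equation $(k)$ if $$\frac{1+(-1)^{k+1}}{2}=\sum_{i=1}^{k}(-1)^{i+1}x_i x_{2k+2-i}.$$ Whether equation $(k)$ holds depends only on the first $2k+1$ elements of the sequence, so for the sequence $z$ the equation $(k)$ is to be read as this identity with $z_1,\dots,z_{2k+1}$ in place of $x_1,\dots,x_{2k+1}$. The run length encoding of a finite sequence is the list of the lengths of its successive maximal blocks of equal consecutive elements. -}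

module Defs where

open import Data.Bool.Base using (if_then_else_)
open import Data.Fin.Base using (Fin; toℕ; fromℕ<)
open import Data.Fin.Properties using (toℕ<n)
open import Data.Integer.Base using (ℤ; 0ℤ; 1ℤ; -1ℤ; _/ℕ_; _^_)
  renaming (_+_ to _+ℤ_; _*_ to _*ℤ_)
import Data.Integer.Properties as ℤ
open import Data.List.Base using (List; []; _∷_)
open import Data.Nat.Base
  using (ℕ; suc; NonZero; _+_; _*_; _∸_; _/_; _≤_; _<_; z≤n; s≤s)
open import Data.Nat.DivMod using (m/n*n≤m; /-monoˡ-≤)
open import Data.Nat.Properties
open import Data.Sum.Base using (_⊎_)
open import Data.Vec.Base using (Vec; lookup; tabulate)
open import Data.Vec.Relation.Unary.All using (All)
open import Relation.Binary.PropositionalEquality using (_≡_; cong)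
open import Relation.Nullary.Decidable using (does)

open import Algebra.Properties.Monoid.Sum ℤ.+-0-monoid using (sum)

Binary : ∀ {n} → Vec ℤ n → Set
Binary = All (λ a → a ≡ -1ℤ ⊎ a ≡ 1ℤ)

-- The i-th element, counting from 1.
term : ∀ {A : Set} {n} → Vec A n → (i : ℕ) → .(1 ≤ i) → .(i ≤ n) → A
term x (suc i) _ i<n = lookup x (fromℕ< i<n)

private
  mirror-positive : ∀ k (j : Fin k) → 1 ≤ 2 * k + 2 ∸ suc (toℕ j)
  mirror-positive k j = m<n⇒0<n∸m (begin-strict
    suc (toℕ j)  ≤⟨ toℕ<n j ⟩
    k            ≤⟨ m≤m+n k (k + 0) ⟩
    2 * k        <⟨ m<m+n (2 * k) (s≤s z≤n) ⟩
    2 * k + 2    ∎)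
    where open ≤-Reasoning

  mirror-bounded : ∀ {n} k (j : Fin k) → 2 * k + 1 ≤ n →
                   2 * k + 2 ∸ suc (toℕ j) ≤ n
  mirror-bounded {n} k j 2k+1≤n = begin
    2 * k + 2 ∸ suc (toℕ j)    ≡⟨ cong (_∸ suc (toℕ j)) (+-suc (2 * k) 1) ⟩
    2 * k + 1 ∸ toℕ j          ≤⟨ m∸n≤m (2 * k + 1) (toℕ j) ⟩
    2 * k + 1                  ≤⟨ 2k+1≤n ⟩
    n                          ∎
    where open ≤-Reasoning

  index-bounded : ∀ {n} k (j : Fin k) → 2 * k + 1 ≤ n → suc (toℕ j) ≤ n
  index-bounded k j 2k+1≤n =
    ≤-trans (toℕ<n j) (≤-trans (m≤m+n k (k + 0)) (≤-trans (m≤m+n (2 * k) 1) 2k+1≤n))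

-- Equation (k). It involves only the first 2k+1 elements, so it makes sense
-- for every sequence having that many. The division on the left is exact,
-- the numerator being 0 or 2.
Satisfies : ∀ {n} → Vec ℤ n → (k : ℕ) → .(2 * k + 1 ≤ n) → Set
Satisfies x k 2k+1≤n =
  (1ℤ +ℤ -1ℤ ^ (k + 1)) /ℕ 2 ≡
  sum {k} λ j → let i = suc (toℕ j) in
    -1ℤ ^ (i + 1)
      *ℤ term x i (s≤s z≤n) (index-bounded k j 2k+1≤n)
      *ℤ term x (2 * k + 2 ∸ i) (mirror-positive k j) (mirror-bounded k j 2k+1≤n)

increment : List ℕ → List ℕ
increment []       = []
increment (l ∷ ls) = suc l ∷ ls

runLengths : List ℤ → List ℕ
runLengths []           = []
runLengths (a ∷ [])     = 1 ∷ []
runLengths (a ∷ b ∷ bs) =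
  if does (a ℤ.≟ b)
  then increment (runLengths (b ∷ bs))
  else 1 ∷ runLengths (b ∷ bs)

⌈_/_⌉ : ℕ → (p : ℕ) .{{_ : NonZero p}} → ℕ
⌈ n / p ⌉ = (n + (p ∸ 1)) / p

private
  step-bounded : ∀ {n} p .{{_ : NonZero p}} (j : Fin ⌈ n / p ⌉) →
                 p * toℕ j + 1 ≤ n
  step-bounded {n} p@(suc q) j = +-cancelʳ-≤ q (p * toℕ j + 1) n (begin
    p * toℕ j + 1 + q       ≡⟨ +-assoc (p * toℕ j) 1 q ⟩
    p * toℕ j + p           ≡⟨ +-comm (p * toℕ j) p ⟩
    p + p * toℕ j           ≡⟨ *-suc p (toℕ j) ⟨
    p * suc (toℕ j)         ≡⟨ *-comm p (suc (toℕ j)) ⟩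
    suc (toℕ j) * p         ≤⟨ *-monoˡ-≤ p (toℕ<n j) ⟩
    ⌈ n / p ⌉ * p           ≤⟨ m/n*n≤m (n + q) p ⟩
    n + q                   ∎)
    where open ≤-Reasoning

-- The sequence z with z_j = x_{p(j-1)+1}, over all j for which p(j-1)+1 ≤ n.
-- The Fin index of z_j is j-1.
everyNth : ∀ {A : Set} {n} (p : ℕ) .{{_ : NonZero p}} → Vec A n → Vec A ⌈ n / p ⌉
everyNth p x =
  tabulate λ j → term x (p * toℕ j + 1) (m≤n+m 1 (p * toℕ j)) (step-bounded p j)

module _ {n : ℕ} (53<n : 53 < n) where

  inPrefix : ∀ {i} → i ≤ 53 → i ≤ n
  inPrefix i≤53 = ≤-trans i≤53 (<⇒≤ 53<n)

  equationInRange : ∀ {k} → k ≤ 26 → 2 * k + 1 ≤ n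
  equationInRange k≤26 = inPrefix (+-monoˡ-≤ 1 (*-monoʳ-≤ 2 k≤26))

  equation5InRange : 2 * 5 + 1 ≤ ⌈ n / 5 ⌉
  equation5InRange = /-monoˡ-≤ 5 (≤-trans (≤ᵇ⇒≤ 55 58 _) (+-monoˡ-≤ 4 53<n))

{-# OPTIONS --safe #-}

-- A binary sequence is recovered from its first element and its run lengths,
-- so the first 53 elements of x form one of two explicit words. All the claims
-- depend on those elements only, and for each word they are decided by
-- evaluation.
module Submission where

open import Defs
open import Data.Fin.Base using (Fin; toℕ; fromℕ<)
import Data.Fin.Properties as Fin
open import Data.Integer.Base using (ℤ; +_; 1ℤ; -1ℤ; -_; _^_)
  renaming (_*_ to _*ℤ_)
import Data.Integer.Properties as ℤ
open import Data.List.Base using (List; _∷_; []; _++_; replicate; take)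
open import Data.List.Properties using (∷-injectiveˡ; ∷-injectiveʳ)
import Data.List.Relation.Unary.All as List
import Data.List.Relation.Unary.All.Properties as List
open import Data.Nat.Base
  using (ℕ; suc; NonZero; _+_; _*_; _∸_; _≤_; _<_; s≤s; z≤n; s≤s⁻¹)
open import Data.Nat.DivMod using (/-monoˡ-≤)
open import Data.Nat.Properties
  using (≤-trans; ≤-refl; ≤-reflexive; <⇒≤; ≤ᵇ⇒≤; +-suc; +-monoˡ-≤; *-monoʳ-≤; m≤m+n; m∸n≤m;
         m<n⇒0<n∸m)
open import Data.Product.Base using (_×_; _,_)
open import Data.Rational.Base using (_/_) renaming (_≤_ to _≤ℚ_)
import Data.Rational.Properties as ℚ
open import Data.Sum.Base using (_⊎_; inj₁; inj₂)
open import Data.Vec.Base using (Vec; []; _∷_; fromList; toList)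
open import Data.Vec.Properties using (lookup∘tabulate)
import Data.Vec.Relation.Unary.All.Properties as Vec
open import Function.Base using (id; _∘_)
open import Relation.Binary.PropositionalEquality
  using (_≡_; refl; sym; trans; cong; cong₂; subst)
open import Relation.Nullary using (¬_; Dec; yes; no; contradiction)
open import Relation.Nullary.Decidable using (map′; _×-dec_; ¬?; from-yes)

open import Algebra.Properties.Monoid.Sum ℤ.+-0-monoid using (sum-cong-≋)

private
  variable
    A : Set
    m n N : ℕ

decode : ℤ → List ℕ → List ℤ
decode a []       = []
decode a (l ∷ ls) = replicate l a ++ decode (- a) ls

private
  opposite : ∀ {a b} → a ≡ -1ℤ ⊎ a ≡ 1ℤ → b ≡ -1ℤ ⊎ b ≡ 1ℤ → ¬ a ≡ b → b ≡ - a
  opposite (inj₁ refl) (inj₁ refl) a≢b = contradiction refl a≢b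
  opposite (inj₁ refl) (inj₂ refl) a≢b = refl
  opposite (inj₂ refl) (inj₁ refl) a≢b = refl
  opposite (inj₂ refl) (inj₂ refl) a≢b = contradiction refl a≢b

-- With only two values available, the value after a change is the negative of the one before, so
-- the signs of the blocks alternate as in `decode`.
decode-runLengths : ∀ a as → List.All (λ b → b ≡ -1ℤ ⊎ b ≡ 1ℤ) (a ∷ as) →
                    decode a (runLengths (a ∷ as)) ≡ a ∷ as
decode-runLengths a []       _ = refl
decode-runLengths a (b ∷ bs) (pa List.∷ pb List.∷ pbs)
  with a ℤ.≟ b | runLengths (b ∷ bs) | decode-runLengths b bs (pb List.∷ pbs)
-- Here the induction hypothesis would equate `[]` with a nonempty list, so `increment` never meets
-- its default case.
... | yes refl | []     | ()
... | yes refl | l ∷ ls | ih = cong (a ∷_) ih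
... | no a≢b   | ls     | ih =
  cong (a ∷_) (trans (cong (λ c → decode c ls) (sym (opposite pa pb a≢b))) ih)

-- The lengths may differ and either may be below `N`: only positions present in both vectors are
-- compared. Irrelevant bounds let any two proofs of them be exchanged.
Agree : ℕ → Vec A m → Vec A n → Set
Agree {m = m} {n = n} N x y =
  ∀ i .(1≤i : 1 ≤ i) .(i≤m : i ≤ m) .(i≤n : i ≤ n) → i ≤ N →
  term x i 1≤i i≤m ≡ term y i 1≤i i≤n

Agree-mono : ∀ {M N} {x : Vec A m} {y : Vec A n} → M ≤ N → Agree N x y → Agree M x y
Agree-mono M≤N agree i 1≤i i≤m i≤n i≤M = agree i 1≤i i≤m i≤n (≤-trans i≤M M≤N)

agree-at : ∀ {x : Vec A m} {y : Vec A n} .(N≤m : N ≤ m) .(N≤n : N ≤ n) → Agree N x y →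
           ∀ {i} .(1≤i : 1 ≤ i) (i≤N : i ≤ N) →
           term x i 1≤i (≤-trans i≤N N≤m) ≡ term y i 1≤i (≤-trans i≤N N≤n)
agree-at N≤m N≤n agree {i} 1≤i i≤N =
  agree i 1≤i (≤-trans i≤N N≤m) (≤-trans i≤N N≤n) i≤N

take⇒Agree : ∀ N (x : Vec A m) (w : Vec A n) →
             take N (toList x) ≡ toList w → Agree N x w
take⇒Agree (suc N) (a ∷ x) (b ∷ w) eq 1             _ _   _   _   = ∷-injectiveˡ eq
take⇒Agree (suc N) (a ∷ x) (b ∷ w) eq (suc (suc i)) _ i<m i<n i<N =
  take⇒Agree N x w (∷-injectiveʳ eq) (suc i) (s≤s z≤n) (s≤s⁻¹ i<m) (s≤s⁻¹ i<n) (s≤s⁻¹ i<N)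

everyNth-agree : ∀ {x : Vec A m} {y : Vec A n} p .{{_ : NonZero p}} q →
                 Agree (p * q + 1) x y → Agree (suc q) (everyNth p x) (everyNth p y)
everyNth-agree {x = x} {y} p q agree (suc j) _ j<m j<n (s≤s j≤q) =
  trans (lookup∘tabulate _ (fromℕ< j<m))
    (trans (at-step (trans (Fin.toℕ-fromℕ< j<m) (sym (Fin.toℕ-fromℕ< j<n)))
                    (≤-trans (≤-reflexive (Fin.toℕ-fromℕ< j<m)) j≤q))
           (sym (lookup∘tabulate _ (fromℕ< j<n))))
  where
  -- The two indices come from different `Fin` types and their values are only propositionally
  -- equal; with both generalised, matching on `refl` identifies the positions.
  at-step : ∀ {i i′} .{a b c d} → i ≡ i′ → i ≤ q →
            term x (p * i + 1) a b ≡ term y (p * i′ + 1) c d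
  at-step {a = a} {b} {c} {d} refl i≤q =
    agree _ a b d (+-monoˡ-≤ 1 (*-monoʳ-≤ p i≤q))

-- The sum reads only positions `i` and `2k+2-i` with `1 ≤ i ≤ k`, all between `1` and `2k+1`. An
-- equality of types serves both to transfer equations and to transfer the failure of one.
Satisfies-cong : ∀ {x : Vec ℤ m} {y : Vec ℤ n} k
                 .(k≤m : 2 * k + 1 ≤ m) .(k≤n : 2 * k + 1 ≤ n) →
                 Agree (2 * k + 1) x y → Satisfies x k k≤m ≡ Satisfies y k k≤n
Satisfies-cong k k≤m k≤n agree = cong (_ ≡_) (sum-cong-≋ λ j →
  cong₂ _*ℤ_
    (cong (-1ℤ ^ (suc (toℕ j) + 1) *ℤ_) (agree-at k≤m k≤n agree (s≤s z≤n) (index≤ j)))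
    (agree-at k≤m k≤n agree (m<n⇒0<n∸m (mirror-positive j)) (mirror≤ j)))
  where
  index≤ : ∀ (j : Fin k) → suc (toℕ j) ≤ 2 * k + 1
  index≤ j = ≤-trans (Fin.toℕ<n j) (≤-trans (m≤m+n k (k + 0)) (m≤m+n (2 * k) 1))

  mirror-positive : ∀ (j : Fin k) → suc (toℕ j) < 2 * k + 2
  mirror-positive j = ≤-trans (s≤s (index≤ j)) (≤-reflexive (sym (+-suc (2 * k) 1)))

  mirror≤ : ∀ (j : Fin k) → 2 * k + 2 ∸ suc (toℕ j) ≤ 2 * k + 1
  mirror≤ j = ≤-trans (≤-reflexive (cong (_∸ suc (toℕ j)) (+-suc (2 * k) 1)))
                      (m∸n≤m (2 * k + 1) (toℕ j))

allFromOne? : ∀ {P : ∀ i → .(1 ≤ i) → .(i ≤ n) → Set} →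
              (∀ i .(1≤i : 1 ≤ i) .(i≤n : i ≤ n) → Dec (P i 1≤i i≤n)) →
              Dec (∀ i (1≤i : 1 ≤ i) (i≤n : i ≤ n) → P i 1≤i i≤n)
allFromOne? {n} {P} P? =
  map′ fromFin (λ f j → f (suc (toℕ j)) (s≤s z≤n) (Fin.toℕ<n j))
    (Fin.all? λ j → P? (suc (toℕ j)) (s≤s z≤n) (Fin.toℕ<n j))
  where
  fromFin : (∀ (j : Fin n) → P (suc (toℕ j)) (s≤s z≤n) (Fin.toℕ<n j)) →
            ∀ i (1≤i : 1 ≤ i) (i≤n : i ≤ n) → P i 1≤i i≤n
  fromFin f (suc i) _ i<n =
    -- The bound depends on `i`, so the motive quantifies over it and it is supplied after the
    -- transport.
    subst (λ i → .(i<n : i < n) → P (suc i) (s≤s z≤n) i<n)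
      (Fin.toℕ-fromℕ< i<n) (λ _ → f (fromℕ< i<n)) i<n

11≤⌈n/5⌉ : 53 ≤ n → 2 * 5 + 1 ≤ ⌈ n / 5 ⌉
-- `55 = 11 * 5`, and `57 = 53 + 4` is the least numerator in the rounded-up quotient.
11≤⌈n/5⌉ 53≤n = /-monoˡ-≤ 5 (≤-trans (≤ᵇ⇒≤ 55 57 _) (+-monoˡ-≤ 4 53≤n))

-- Stated for n ≥ 53 instead of n > 53 so as to apply to the words of length 53.
Claims : .(53 ≤ n) → Vec ℤ n → Set
Claims 53≤n x =
    (∀ i (1≤i : 1 ≤ i) (i≤5 : i ≤ 5) →
       term x i 1≤i (≤-trans i≤5 (≤-trans (≤ᵇ⇒≤ 5 53 _) 53≤n)) ≡ 1ℤ)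
  × term x 6 (s≤s z≤n) (≤-trans (≤ᵇ⇒≤ 6 53 _) 53≤n) ≡ -1ℤ
  × (∀ k → 1 ≤ k → (k≤26 : k ≤ 26) →
       Satisfies x k (≤-trans (+-monoˡ-≤ 1 (*-monoʳ-≤ 2 k≤26)) 53≤n))
  × ¬ Satisfies (everyNth 5 x) 5 (11≤⌈n/5⌉ 53≤n)

Claims? : .(53≤n : 53 ≤ n) (x : Vec ℤ n) → Dec (Claims 53≤n x)
Claims? 53≤n x =
  allFromOne? (λ _ _ _ → _ ℤ.≟ _)
  ×-dec _ ℤ.≟ _
  ×-dec allFromOne? (λ _ _ _ → _ ℤ.≟ _)
  ×-dec ¬? (_ ℤ.≟ _)

Claims-agree : .(53≤m : 53 ≤ m) .(53≤n : 53 ≤ n) {x : Vec ℤ m} {y : Vec ℤ n} →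
               Agree 53 x y → Claims 53≤n y → Claims 53≤m x
Claims-agree 53≤m 53≤n agree (ones , minusOne , equations , fails) =
    (λ i 1≤i i≤5 → trans (agree-at 53≤m 53≤n agree 1≤i (≤-trans i≤5 (≤ᵇ⇒≤ 5 53 _)))
                         (ones i 1≤i i≤5))
  , trans (agree-at 53≤m 53≤n agree (s≤s z≤n) (≤ᵇ⇒≤ 6 53 _)) minusOne
  , (λ k 1≤k k≤26 →
       -- The prefix is exactly long enough: `2 * 26 + 1 = 53`.
       let 2k+1≤53 = +-monoˡ-≤ 1 (*-monoʳ-≤ 2 k≤26)
       in subst id
            (sym (Satisfies-cong k (≤-trans 2k+1≤53 53≤m) (≤-trans 2k+1≤53 53≤n)
              (Agree-mono 2k+1≤53 agree)))
            (equations k 1≤k k≤26))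
  , fails ∘ subst id (Satisfies-cong 5 (11≤⌈n/5⌉ 53≤m) (11≤⌈n/5⌉ 53≤n)
      (everyNth-agree 5 10 (Agree-mono (≤ᵇ⇒≤ 51 53 _) agree)))

word₁ word₂ : Vec ℤ 53
word₁ = fromList (decode 1ℤ (5 ∷ 5 ∷ 5 ∷ 5 ∷ 10 ∷ 10 ∷ 9 ∷ 4 ∷ []))
word₂ = fromList (decode 1ℤ (5 ∷ 5 ∷ 10 ∷ 5 ∷ 15 ∷ 5 ∷ 4 ∷ 1 ∷ 3 ∷ []))

-- For both words, equation (5) for z has left side 1 and right side -1.
claims₁ : Claims ≤-refl word₁
claims₁ = from-yes (Claims? ≤-refl word₁)

claims₂ : Claims ≤-refl word₂
claims₂ = from-yes (Claims? ≤-refl word₂)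

mainTheorem3 :
  ∀ (n : ℕ) (53<n : 53 < n) (x : Vec ℤ n) → Binary x →
  term x 1 (s≤s z≤n) (inPrefix 53<n (≤ᵇ⇒≤ 1 53 _)) ≡ 1ℤ →
  runLengths (take 53 (toList x)) ≡ 5 ∷ 5 ∷ 5 ∷ 5 ∷ 10 ∷ 10 ∷ 9 ∷ 4 ∷ []
    ⊎ runLengths (take 53 (toList x)) ≡ 5 ∷ 5 ∷ 10 ∷ 5 ∷ 15 ∷ 5 ∷ 4 ∷ 1 ∷ 3 ∷ [] →
  let p = 5
      t = 26
      z = everyNth p x
  in
  (∀ i (1≤i : 1 ≤ i) (i≤p : i ≤ p) →
     term x i 1≤i (inPrefix 53<n (≤-trans i≤p (≤ᵇ⇒≤ p 53 _))) ≡ 1ℤ)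
  × term x (p + 1) (s≤s z≤n) (inPrefix 53<n (≤ᵇ⇒≤ (p + 1) 53 _)) ≡ -1ℤ
  × (∀ k → 1 ≤ k → (k≤t : k ≤ t) → Satisfies x k (equationInRange 53<n k≤t))
  × ¬ Satisfies z 5 (equation5InRange 53<n)
  × (+ 5 / 1) ≤ℚ (+ t / p)
-- Matching `refl` turns `a` into `1ℤ`, the value from which the decoding starts.
mainTheorem3 (suc n) 53<n x@(a ∷ as) binary refl runs =
  let (ones , minusOne , equations , fails) = claims runs
  -- The bounds in `Claims` are built differently from those in the goal, but being irrelevant they
  -- need no conversion.
  in ones , minusOne , equations , fails , from-yes ((+ 5 / 1) ℚ.≤? (+ 26 / 5))
  where
  prefix : ∀ {ls} → runLengths (take 53 (toList x)) ≡ ls → take 53 (toList x) ≡ decode 1ℤ ls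
  prefix refl = sym (decode-runLengths _ _ (List.take⁺ 53 (Vec.toList⁺ binary)))

  claims : _ → Claims (<⇒≤ 53<n) x
  claims (inj₁ runs₁) =
    Claims-agree (<⇒≤ 53<n) ≤-refl (take⇒Agree 53 x word₁ (prefix runs₁)) claims₁
  claims (inj₂ runs₂) =
    Claims-agree (<⇒≤ 53<n) ≤-refl (take⇒Agree 53 x word₂ (prefix runs₂)) claims₂
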